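{- Let $(X,x_0)$ and $(Y,y_0)$ be pointed finite sets, and let $Z$, $L_X$ and $L_Y$ be as defined in the context. For every finite family $\alpha_1,\dots,\alpha_r\in\mathrm{Part}(X)$ (possibly empty), \[ \bigvee_{j=1}^r L_X(\alpha_j)=L_X\Bigl(\bigvee_{j=1}^r\alpha_j\Bigr). \] The symmetric statement holds for $L_Y$: for every finite family $\beta_1,\dots,\beta_r\in\mathrm{Part}(Y)$, $\bigvee_{j=1}^r L_Y(\beta_j)=L_Y\bigl(\bigvee_{j=1}^r\beta_j\bigr)$.
   Context: For a finite set $W$, $\mathrm{Part}(W)$ is the set of partitions of $W$, ordered by refinement ($\pi\preceq\sigma$ iff every block of $\pi$ is contained in a block of $\sigma$). The join $\bigvee$ of a family is the finest partition coarser than all its members; the join of the empty family is the discrete partition $\mathbf 0_W$. Pointed lifts. Let $X^\circ=X\setminus\{x_0\}$, $Y^\circ=Y\setminus\{y_0\}$ and $Z=\{z_0\}\cup(X^\circ\times Y^\circ)$, where $z_0$ is a new point. For $\alpha\in\mathrm{Part}(X)$ let $A_0$ be the block of $\alpha$ containing $x_0$; $L_X(\alpha)\in\mathrm{Part}(Z)$ is the partition whose blocks are $\{z_0\}\cup\bigl((A_0\setminus\{x_0\})\times Y^\circ\bigr)$ and the sets $A\times\{y\}$ for every block $A\in\alpha\setminus\{A_0\}$ and every $y\in Y^\circ$. Symmetrically, for $\beta\in\mathrm{Part}(Y)$ with $B_0$ the block containing $y_0$, $L_Y(\beta)\in\mathrm{Part}(Z)$ has blocks $\{z_0\}\cup\bigl(X^\circ\times(B_0\setminus\{y_0\})\bigr)$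 and $\{x\}\times B$ for every $B\in\beta\setminus\{B_0\}$ and every $x\in X^\circ$. -}

module Defs where

open import Data.Empty using (⊥; ⊥-elim)
open import Data.Fin using (Fin; zero; suc; punchIn; punchOut)
open import Data.Fin.Properties as Fin using (any?)
open import Data.Irrelevant using ([_])
open import Data.List using (List; []; _∷_; map; filter; allFin; cartesianProduct)
open import Data.List.Membership.Propositional using (_∈_)
open import Data.List.Membership.Propositional.Properties
  using (∈-map⁺; ∈-allFin; ∈-filter⁺; ∈-filter⁻; ∈-cartesianProduct⁺)
open import Data.List.Relation.Unary.All as All using (All; []; _∷_)
open import Data.List.Relation.Unary.Any using (here; there)
open import Data.Maybe using (Maybe; just; nothing)
open import Data.Maybe.Properties using (≡-dec)
open import Data.Nat using (ℕ; zero; suc)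
open import Data.Product using (∃; _×_; _,_; proj₁; proj₂)
open import Data.Product.Function.NonDependent.Propositional using (_×-↔_)
import Data.Product.Properties as Product
open import Data.Refinement using (Refinement-syntax; value) renaming (_,_ to infixr 5 _given_)
open import Data.Unit using (⊤; tt)
open import Function using (_∘_; id; _↔_; mk↔ₛ′; Inverse)
open import Function.Construct.Composition using (_↔-∘_)
open import Function.Construct.Symmetry using (↔-sym)
open import Function.Properties.Inverse using (↔⇒↣)
open import Level using (0ℓ)
open import Relation.Binary.Definitions using (DecidableEquality)
open import Relation.Binary.PropositionalEquality
open import Relation.Nullary using (¬_; Dec; yes; no; recompute; contradiction)
open import Relation.Nullary.Decidable using (via-injection; map′)
open import Relation.Unary using (Pred; Satisfiable; _⊆_; _≐_)

open Inverse using (to; from; strictlyInverseˡ; strictlyInverseʳ)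

record Finite (W : Set) : Set where
  field
    size        : ℕ
    enumeration : W ↔ Fin size

  infix 4 _≟_
  _≟_ : DecidableEquality W
  _≟_ = via-injection (↔⇒↣ enumeration) Fin._≟_

  elements : List W
  elements = map (from enumeration) (allFin size)

  ∈-elements : ∀ w → w ∈ elements
  ∈-elements w = subst (_∈ elements) (strictlyInverseʳ enumeration w)
    (∈-map⁺ (from enumeration) (∈-allFin (to enumeration w)))

open Finite using (size; enumeration)

-- The proof of v ≢ w is irrelevant, so elements of W ∖ w are equal as soon as
-- their values are.
infix 8 _∖_
_∖_ : (W : Set) → W → Set
W ∖ w = [ v ∈ W ∣ v ≢ w ]

value-injective : ∀ {W : Set} {P : Pred W 0ℓ} {u v : [ w ∈ W ∣ P w ]} → value u ≡ value v → u ≡ v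
value-injective refl = refl

refinement-≟ : ∀ {W : Set} {P : Pred W 0ℓ} → DecidableEquality W → DecidableEquality [ w ∈ W ∣ P w ]
refinement-≟ _≟_ u v = map′ value-injective (cong value) (value u ≟ value v)

-- A partition is an indexed family of pairwise disjoint nonempty sets covering
-- W. Disjointness is stated so that the indexing is injective: Block is in
-- bijection with the set of blocks. Equality of blocks is decidable, which is
-- automatic classically; together with cover it makes membership decidable.
record Partition (W : Set) : Set₁ where
  field
    Block    : Set
    ⟦_⟧      : Block → Pred W 0ℓ
    nonempty : ∀ A → Satisfiable ⟦ A ⟧
    cover    : ∀ w → ∃ λ A → ⟦ A ⟧ w
    disjoint : ∀ {A B w} → ⟦ A ⟧ w → ⟦ B ⟧ w → A ≡ B
    _≟_      : DecidableEquality Block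

  blockOf : W → Block
  blockOf w = proj₁ (cover w)

  ∈-blockOf : ∀ w → ⟦ blockOf w ⟧ w
  ∈-blockOf w = proj₂ (cover w)

open Partition using (Block; blockOf; ∈-blockOf)

infix 4 _≼_ _≈_

_≼_ : ∀ {W} → Partition W → Partition W → Set
π ≼ σ = ∀ A → ∃ λ B → π.⟦ A ⟧ ⊆ σ.⟦ B ⟧
  where module π = Partition π ; module σ = Partition σ

-- Equality of partitions as sets of blocks.
_≈_ : ∀ {W} → Partition W → Partition W → Set
π ≈ σ = (∀ A → ∃ λ B → π.⟦ A ⟧ ≐ σ.⟦ B ⟧) × (∀ B → ∃ λ A → π.⟦ A ⟧ ≐ σ.⟦ B ⟧)
  where module π = Partition π ; module σ = Partition σ

record IsJoin {W : Set} {r : ℕ} (π : Fin r → Partition W) (σ : Partition W) : Set₁ where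
  field
    coarser : ∀ j → π j ≼ σ
    finest  : ∀ τ → (∀ j → π j ≼ τ) → σ ≼ τ

-- The join is computed by a naive union–find. A function f : W → W sends every
-- point to a representative of its class; starting from the identity (whose
-- classes are singletons), the classes of all pairs of points lying in a common
-- block of some member of the family are merged. ⋁-isJoin shows that the result
-- is the finest partition coarser than all members.
module _ {W : Set} {{fin : Finite W}} where
  open Finite fin using (_≟_; elements; ∈-elements)

  redirect : (u v w : W) → W
  redirect u v w with w ≟ u
  ... | yes _ = v
  ... | no  _ = w

  glue : List (W × W) → W → W
  glue []             = id
  glue ((u , v) ∷ ps) = redirect (glue ps u) (glue ps v) ∘ glue ps

  redirect-merges : ∀ u v → redirect u v u ≡ redirect u v v
  redirect-merges u v with u ≟ u | v ≟ u
  ... | yes _  | yes _ = refl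
  ... | yes _  | no  _ = refl
  ... | no u≢u | _     = contradiction refl u≢u

  redirect-invariant : ∀ {B : Set} (g : W → B) {u v} → g u ≡ g v → ∀ w → g (redirect u v w) ≡ g w
  redirect-invariant g {u} gu≡gv w with w ≟ u
  ... | yes refl = sym gu≡gv
  ... | no  _    = refl

  glue-merges : ∀ {u v} ps → (u , v) ∈ ps → glue ps u ≡ glue ps v
  glue-merges ((u , v) ∷ ps) (here refl) = redirect-merges (glue ps u) (glue ps v)
  glue-merges ((u , v) ∷ ps) (there p)   =
    cong (redirect (glue ps u) (glue ps v)) (glue-merges ps p)

  glue-invariant : ∀ {B : Set} (g : W → B) ps → All (λ (u , v) → g u ≡ g v) ps →
                   ∀ w → g (glue ps w) ≡ g w
  glue-invariant g []             []        w = refl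
  glue-invariant g ((u , v) ∷ ps) (e ∷ es) w = trans
    (redirect-invariant g (trans (ih u) (trans e (sym (ih v)))) (glue ps w))
    (ih w)
    where ih = glue-invariant g ps es

  fibres : (f : W → W) → (∀ w → f (f w) ≡ f w) → Partition W
  fibres f idem = record
    { Block    = [ u ∈ W ∣ f u ≡ u ]
    ; ⟦_⟧      = λ A w → f w ≡ value A
    ; nonempty = λ { (u given [ e ]) → u , recompute (f u ≟ u) e }
    ; cover    = λ w → (f w given [ idem w ]) , refl
    ; disjoint = λ p q → value-injective (trans (sym p) q)
    ; _≟_      = refinement-≟ _≟_
    }

  module _ {r : ℕ} (π : Fin r → Partition W) where

    Together : Pred (W × W) 0ℓ
    Together (u , v) = ∃ λ j → blockOf (π j) u ≡ blockOf (π j) v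

    together? : ∀ p → Dec (Together p)
    together? (u , v) = any? λ j → Partition._≟_ (π j) (blockOf (π j) u) (blockOf (π j) v)

    togetherPairs : List (W × W)
    togetherPairs = filter together? (cartesianProduct elements elements)

    representative : W → W
    representative = glue togetherPairs

    representative-idem : ∀ w → representative (representative w) ≡ representative w
    representative-idem = glue-invariant representative togetherPairs
      (All.tabulate (glue-merges togetherPairs))

    ⋁ : Partition W
    ⋁ = fibres representative representative-idem

    ⋁-isJoin : IsJoin π ⋁
    ⋁-isJoin = record { coarser = coarser ; finest = finest }
      where
      coarser : ∀ j → π j ≼ ⋁
      coarser j A =
        let module πj = Partition (π j)
            u , u∈A = πj.nonempty A
        in blockOf ⋁ u , λ {w} w∈A → glue-merges togetherPairs
             (∈-filter⁺ together?
               (∈-cartesianProduct⁺ (∈-elements w) (∈-elements u))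
               (j , trans (πj.disjoint (∈-blockOf (π j) w) w∈A)
                          (πj.disjoint u∈A (∈-blockOf (π j) u))))

      finest : ∀ τ → (∀ j → π j ≼ τ) → ⋁ ≼ τ
      finest τ π≼τ A = blockOf τ (value A) , λ {w} w∈A →
        subst (λ B → τ.⟦ B ⟧ w)
          (trans (sym (invariant w)) (cong (blockOf τ) w∈A)) (∈-blockOf τ w)
        where
        module τ = Partition τ
        together⇒≡ : ∀ {p} → p ∈ togetherPairs → blockOf τ (proj₁ p) ≡ blockOf τ (proj₂ p)
        together⇒≡ {u , v} p∈ with ∈-filter⁻ together? {xs = cartesianProduct elements elements} p∈
        ... | _ , j , e =
          let B , A⊆B = π≼τ j (blockOf (π j) u)
              v∈A     = subst (λ C → Partition.⟦_⟧ (π j) C v) (sym e) (∈-blockOf (π j) v)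
          in trans (τ.disjoint (∈-blockOf τ u) (A⊆B (∈-blockOf (π j) u)))
                   (τ.disjoint (A⊆B v∈A) (∈-blockOf τ v))
        invariant : ∀ w → blockOf τ (representative w) ≡ blockOf τ w
        invariant = glue-invariant (blockOf τ) togetherPairs (All.tabulate together⇒≡)

-- Z = {z₀} ∪ (X° × Y°), with z₀ encoded as nothing.
Z : {X Y : Set} → X → Y → Set
Z {X} {Y} x₀ y₀ = Maybe (X ∖ x₀ × Y ∖ y₀)

pattern z₀     = nothing
pattern pt x y = just (x , y)

Fin-∖ : ∀ {n} (i : Fin (suc n)) → Fin (suc n) ∖ i ↔ Fin n
Fin-∖ {n} i = mk↔ₛ′ out into out-into into-out
  where
  i≢ : (j : Fin (suc n) ∖ i) → i ≢ value j
  i≢ (j given [ j≢i ]) i≡j = recompute (no id) (j≢i (sym i≡j))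

  out : Fin (suc n) ∖ i → Fin n
  out j = punchOut (i≢ j)

  into : Fin n → Fin (suc n) ∖ i
  into k = punchIn i k given [ Fin.punchInᵢ≢i i k ]

  out-into : ∀ k → out (into k) ≡ k
  out-into k = trans (Fin.punchOut-cong i refl) (Fin.punchOut-punchIn i)

  into-out : ∀ j → into (out j) ≡ j
  into-out j = value-injective (Fin.punchIn-punchOut (i≢ j))

∖-cong : ∀ {V W : Set} (e : V ↔ W) v → V ∖ v ↔ W ∖ to e v
∖-cong e v = mk↔ₛ′
  (λ { (x given [ p ]) → to e x given
       [ (λ q → p (trans (sym (strictlyInverseʳ e x)) (trans (cong (from e) q) (strictlyInverseʳ e v)))) ] })
  (λ { (y given [ p ]) → from e y given
       [ (λ q → p (trans (sym (strictlyInverseˡ e y)) (cong (to e) q))) ] })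
  (λ y → value-injective (strictlyInverseˡ e (value y)))
  (λ x → value-injective (strictlyInverseʳ e (value x)))

Maybe-Fin : ∀ {W : Set} {n} → W ↔ Fin n → Maybe W ↔ Fin (suc n)
Maybe-Fin e = mk↔ₛ′
  (λ { nothing → zero ; (just w) → suc (to e w) })
  (λ { zero → nothing ; (suc i) → just (from e i) })
  (λ { zero → refl ; (suc i) → cong suc (strictlyInverseˡ e i) })
  (λ { nothing → refl ; (just w) → cong just (strictlyInverseʳ e w) })

∖-finite : ∀ {W} → Finite W → (w : W) → Finite (W ∖ w)
∖-finite {W} record { size = n ; enumeration = e } w = helper n e
  where
  helper : ∀ n → W ↔ Fin n → Finite (W ∖ w)
  helper zero    e with () ← to e w
  helper (suc n) e = record { size = n ; enumeration = Fin-∖ (to e w) ↔-∘ ∖-cong e w }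

instance
  Z-finite : ∀ {X Y} {{_ : Finite X}} {{_ : Finite Y}} {x₀ : X} {y₀ : Y} → Finite (Z x₀ y₀)
  Z-finite {{finX}} {{finY}} {x₀} {y₀} = record
    { enumeration = Maybe-Fin (↔-sym Fin.*↔× ↔-∘ (enumeration X° ×-↔ enumeration Y°)) }
    where
    X° = ∖-finite finX x₀
    Y° = ∖-finite finY y₀

module _ {X Y : Set} (x₀ : X) (y₀ : Y) where

  -- In the lifts, the block with index nothing is the one containing z₀. The
  -- points of X° in A₀ are exactly the points of A₀ ∖ {x₀}. Finiteness of Y is
  -- only used to decide equality of the blocks A × {y}; dually for L-Y.
  L-X : {{Finite Y}} → Partition X → Partition (Z x₀ y₀)
  L-X {{finY}} α = record
    { Block    = Maybe (Block α ∖ A₀ × Y ∖ y₀)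
    ; ⟦_⟧      = ⟪_⟫
    ; nonempty = λ
        { nothing → z₀ , tt
        ; (just (A given [ A≢A₀ ] , y)) →
            let x , x∈A = α.nonempty A
            in pt (x given [ (λ { refl → A≢A₀ (α.disjoint x∈A (∈-blockOf α x₀)) }) ]) y , x∈A , refl
        }
    ; cover    = cover
    ; disjoint = λ {A} {B} {z} → disjoint A B z
    ; _≟_      = ≡-dec (Product.≡-dec (refinement-≟ α._≟_) (refinement-≟ (Finite._≟_ finY)))
    }
    where
    module α = Partition α
    A₀ = blockOf α x₀

    ⟪_⟫ : Maybe (Block α ∖ A₀ × Y ∖ y₀) → Pred (Z x₀ y₀) 0ℓ
    ⟪ nothing      ⟫ z₀       = ⊤
    ⟪ nothing      ⟫ (pt x _) = α.⟦ A₀ ⟧ (value x)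
    ⟪ just (_ , _) ⟫ z₀       = ⊥
    ⟪ just (A , y) ⟫ (pt x v) = α.⟦ value A ⟧ (value x) × v ≡ y

    cover : ∀ z → ∃ λ A → ⟪ A ⟫ z
    cover z₀ = nothing , tt
    cover (pt x y) with blockOf α (value x) α.≟ A₀ | ∈-blockOf α (value x)
    ... | yes e | x∈A = nothing , subst (λ A → α.⟦ A ⟧ (value x)) e x∈A
    ... | no  n | x∈A = just ((_ given [ n ]) , y) , x∈A , refl

    disjoint : ∀ A B z → ⟪ A ⟫ z → ⟪ B ⟫ z → A ≡ B
    disjoint nothing nothing _ _ _ = refl
    disjoint nothing (just (B given [ B≢A₀ ] , _)) (pt _ _) p (q , _) =
      ⊥-elim (recompute (no id) (B≢A₀ (α.disjoint q p)))
    disjoint (just (A given [ A≢A₀ ] , _)) nothing (pt _ _) (p , _) q =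
      ⊥-elim (recompute (no id) (A≢A₀ (α.disjoint p q)))
    disjoint (just _) (just _) (pt _ _) (p , refl) (q , refl) =
      cong (λ A → just (A , _)) (value-injective (α.disjoint p q))

  L-Y : {{Finite X}} → Partition Y → Partition (Z x₀ y₀)
  L-Y {{finX}} β = record
    { Block    = Maybe (X ∖ x₀ × Block β ∖ B₀)
    ; ⟦_⟧      = ⟪_⟫
    ; nonempty = λ
        { nothing → z₀ , tt
        ; (just (x , (B given [ B≢B₀ ]))) →
            let y , y∈B = β.nonempty B
            in pt x (y given [ (λ { refl → B≢B₀ (β.disjoint y∈B (∈-blockOf β y₀)) }) ]) , refl , y∈B
        }
    ; cover    = cover
    ; disjoint = λ {A} {B} {z} → disjoint A B z
    ; _≟_      = ≡-dec (Product.≡-dec (refinement-≟ (Finite._≟_ finX)) (refinement-≟ β._≟_))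
    }
    where
    module β = Partition β
    B₀ = blockOf β y₀

    ⟪_⟫ : Maybe (X ∖ x₀ × Block β ∖ B₀) → Pred (Z x₀ y₀) 0ℓ
    ⟪ nothing      ⟫ z₀       = ⊤
    ⟪ nothing      ⟫ (pt _ y) = β.⟦ B₀ ⟧ (value y)
    ⟪ just (_ , _) ⟫ z₀       = ⊥
    ⟪ just (x , B) ⟫ (pt u y) = u ≡ x × β.⟦ value B ⟧ (value y)

    cover : ∀ z → ∃ λ B → ⟪ B ⟫ z
    cover z₀ = nothing , tt
    cover (pt x y) with blockOf β (value y) β.≟ B₀ | ∈-blockOf β (value y)
    ... | yes e | y∈B = nothing , subst (λ B → β.⟦ B ⟧ (value y)) e y∈B
    ... | no  n | y∈B = just (x , (_ given [ n ])) , refl , y∈B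

    disjoint : ∀ A B z → ⟪ A ⟫ z → ⟪ B ⟫ z → A ≡ B
    disjoint nothing nothing _ _ _ = refl
    disjoint nothing (just (_ , (B given [ B≢B₀ ]))) (pt _ _) p (_ , q) =
      ⊥-elim (recompute (no id) (B≢B₀ (β.disjoint q p)))
    disjoint (just (_ , (A given [ A≢B₀ ]))) nothing (pt _ _) (_ , p) q =
      ⊥-elim (recompute (no id) (A≢B₀ (β.disjoint p q)))
    disjoint (just _) (just _) (pt _ _) (refl , p) (refl , q) =
      cong (λ B → just (_ , B)) (value-injective (β.disjoint p q))

{-# OPTIONS --safe #-}
-- Say that g is constant on a partition π when it is constant on every block.
-- A partition is determined by the functions constant on it, and g is constant
-- on ⋁ π exactly when it is constant on every π j. For i in Y°, let ι i : X → Z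
-- send x₀ to z₀ and any other x to (x , i). Then g is constant on L-X α exactly
-- when every g ∘ ι i is constant on α. So both sides of the identity have the
-- same constant functions: those with every g ∘ ι i constant on every α j. The
-- argument for L-Y is the same.
module Submission where

open import Defs
open import Data.Nat using (ℕ)
open import Data.Empty using (⊥-elim-irr)
open import Data.Fin using (Fin)
open import Data.Irrelevant using ([_])
open import Data.List using (cartesianProduct)
open import Data.List.Membership.Propositional.Properties using (∈-filter⁻)
import Data.List.Relation.Unary.All as All
open import Data.Maybe using (Maybe; just; nothing; map)
open import Data.Product using (_×_; _,_; proj₂)
open import Data.Refinement using (value) renaming (_,_ to infixr 5 _given_)
open import Data.Unit using (tt)
open import Function using (_∘_; _⇔_; mk⇔; Equivalence)
open import Relation.Binary.PropositionalEquality
open import Relation.Nullary using (yes; no; contradiction)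

open Equivalence using (to; from)
open Partition using (⟦_⟧; blockOf; ∈-blockOf; nonempty; disjoint)

ConstantOn : {W B : Set} → Partition W → (W → B) → Set
ConstantOn π g = ∀ A u v → ⟦ π ⟧ A u → ⟦ π ⟧ A v → g u ≡ g v

SameConstants : {W : Set} → Partition W → Partition W → Set₁
SameConstants {W} π σ = ∀ {B : Set} (g : W → B) → ConstantOn π g ⇔ ConstantOn σ g

blockOf-constant : ∀ {W} (π : Partition W) → ConstantOn π (blockOf π)
blockOf-constant π A u v u∈A v∈A =
  trans (disjoint π (∈-blockOf π u) u∈A) (disjoint π v∈A (∈-blockOf π v))

≼⇒constant : ∀ {W B} (π σ : Partition W) {g : W → B} → π ≼ σ → ConstantOn σ g → ConstantOn π g
≼⇒constant π σ π≼σ g-const A u v u∈A v∈A =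
  let B , A⊆B = π≼σ A in g-const B u v (A⊆B u∈A) (A⊆B v∈A)

-- Any point `u` of `A` selects the block `blockOf σ u`, and constancy puts the rest of `A` into it.
constant⇒≼ : ∀ {W} (π σ : Partition W) → ConstantOn π (blockOf σ) → π ≼ σ
constant⇒≼ π σ const A =
  let u , u∈A = nonempty π A
  in blockOf σ u , λ {w} w∈A →
       subst (λ B → ⟦ σ ⟧ B w) (const A w u w∈A u∈A) (∈-blockOf σ w)

-- A block `A` of `π` lies in some `B`, and `B` in some block `C` of `π`. As `C` meets `A`, the two
-- coincide, so `A` and `B` have the same points.
≼-antisym : ∀ {W} (π σ : Partition W) → π ≼ σ → σ ≼ π → π ≈ σ
≼-antisym π σ π≼σ σ≼π =
  (λ A → let B , A⊆B = π≼σ A ; C , B⊆C = σ≼π B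
             u , u∈A = nonempty π A
             C≡A = disjoint π (B⊆C (A⊆B u∈A)) u∈A
         in B , A⊆B , λ {w} w∈B → subst (λ D → ⟦ π ⟧ D w) C≡A (B⊆C w∈B)) ,
  (λ B → let A , B⊆A = σ≼π B ; C , A⊆C = π≼σ A
             u , u∈B = nonempty σ B
             C≡B = disjoint σ (A⊆C (B⊆A u∈B)) u∈B
         in A , (λ {w} w∈A → subst (λ D → ⟦ σ ⟧ D w) C≡B (A⊆C w∈A)) , B⊆A)

sameConstants⇒≈ : ∀ {W} (π σ : Partition W) → SameConstants π σ → π ≈ σ
sameConstants⇒≈ π σ same = ≼-antisym π σ
  (constant⇒≼ π σ (from (same (blockOf σ)) (blockOf-constant σ)))
  (constant⇒≼ σ π (to (same (blockOf π)) (blockOf-constant π)))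

-- Each `π j` refines the join, which gives one direction. Conversely, a `g` constant on every `π j`
-- respects every merge of the union-find, so it agrees at a point and at its representative.
⋁-constant : ∀ {W B : Set} {{_ : Finite W}} {r} (π : Fin r → Partition W) (g : W → B) →
             ConstantOn (⋁ π) g ⇔ (∀ j → ConstantOn (π j) g)
⋁-constant {{fin}} π g = mk⇔
  (λ const j → ≼⇒constant (π j) (⋁ π) (IsJoin.coarser (⋁-isJoin π) j) const)
  (λ const A u v u∈A v∈A →
    -- Membership of `w` in the block `A` of the join is the equation
    -- `representative π w ≡ value A`, so `u` and `v` share a representative.
    trans (sym (invariant const u)) (trans (cong g (trans u∈A (sym v∈A))) (invariant const v)))
  where
  open Finite fin using (elements)

  together⇒≡ : (∀ j → ConstantOn (π j) g) → ∀ {u v} → Together π (u , v) → g u ≡ g v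
  together⇒≡ const {u} {v} (j , e) =
    const j (blockOf (π j) v) u v
      (subst (λ A → ⟦ π j ⟧ A u) e (∈-blockOf (π j) u)) (∈-blockOf (π j) v)

  invariant : (∀ j → ConstantOn (π j) g) → ∀ w → g (representative π w) ≡ g w
  invariant const = glue-invariant g (togetherPairs π) (All.tabulate λ p∈ →
    together⇒≡ const (proj₂ (∈-filter⁻ (together? π) {xs = cartesianProduct elements elements} p∈)))

-- L α is the join of the images of α under the maps ι i.
IsLiftAlong : {W V I : Set} → (I → W → V) → (Partition W → Partition V) → Set₁
IsLiftAlong {V = V} ι L =
  ∀ α {B : Set} (g : V → B) → ConstantOn (L α) g ⇔ (∀ i → ConstantOn α (g ∘ ι i))

-- Once both sides are unfolded, only the quantifiers over `i` and `j` have to be exchanged.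
lift-preserves-⋁ : ∀ {W V I : Set} {{_ : Finite W}} {{_ : Finite V}}
  {ι : I → W → V} {L : Partition W → Partition V} → IsLiftAlong ι L →
  ∀ {r} (α : Fin r → Partition W) → ⋁ (L ∘ α) ≈ L (⋁ α)
lift-preserves-⋁ {ι = ι} {L} isLift α = sameConstants⇒≈ (⋁ (L ∘ α)) (L (⋁ α)) λ g → mk⇔
  (λ const → from (isLift (⋁ α) g) λ i → from (⋁-constant α (g ∘ ι i)) λ j →
    to (isLift (α j) g) (to (⋁-constant (L ∘ α) g) const j) i)
  (λ const → from (⋁-constant (L ∘ α) g) λ j → from (isLift (α j) g) λ i →
    to (⋁-constant α (g ∘ ι i)) (to (isLift (⋁ α) g) const i) j)

module _ {W : Set} {{fin : Finite W}} (w₀ : W) where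
  open Finite fin using (_≟_)

  -- One half of the pointed bijection that splits off `w₀` as `nothing`; mapping under `Maybe` then
  -- keeps the base point fixed.
  puncture : W → Maybe (W ∖ w₀)
  puncture w with w ≟ w₀
  ... | yes _ = nothing
  ... | no  n = just (w given [ n ])

  puncture-base : puncture w₀ ≡ nothing
  puncture-base with w₀ ≟ w₀
  ... | yes _ = refl
  ... | no  n = contradiction refl n

  puncture-value : ∀ w → puncture (value w) ≡ just w
  puncture-value (w given [ n ]) with w ≟ w₀
  -- The proof `n` is irrelevant here, so the contradiction is too.
  ... | yes e = ⊥-elim-irr (n e)
  ... | no  _ = refl

module _ {X Y : Set} {{finX : Finite X}} {{finY : Finite Y}} (x₀ : X) (y₀ : Y) where

  row : Y ∖ y₀ → X → Z x₀ y₀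
  row y = map (_, y) ∘ puncture x₀

  column : X ∖ x₀ → Y → Z x₀ y₀
  column x = map (x ,_) ∘ puncture y₀

  -- The block of `z₀` consists of `z₀` and the images of `A₀` under all rows; the block `A × {y}`
  -- is the image of `A` under the single row `y`.
  L-X-isLift : IsLiftAlong row (L-X x₀ y₀)
  L-X-isLift α g = mk⇔ restrict extend
    where
    module α = Partition α
    A₀ = blockOf α x₀
    Lα = L-X x₀ y₀ α

    row-base : ∀ y → row y x₀ ≡ z₀
    row-base y = cong (map (_, y)) (puncture-base x₀)

    row-value : ∀ y x → row y (value x) ≡ pt x y
    row-value y x = cong (map (_, y)) (puncture-value x₀ x)

    row-∈-base : ∀ y u → α.⟦ A₀ ⟧ u → ⟦ Lα ⟧ nothing (row y u)
    row-∈-base y u u∈A₀ with Finite._≟_ finX u x₀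
    ... | yes _ = tt
    ... | no  _ = u∈A₀

    row-∈ : ∀ y A (A≢A₀ : A ≢ A₀) u → α.⟦ A ⟧ u → ⟦ Lα ⟧ (just (A given [ A≢A₀ ] , y)) (row y u)
    row-∈ y A A≢A₀ u u∈A with Finite._≟_ finX u x₀
    ... | yes refl = contradiction (α.disjoint u∈A (∈-blockOf α x₀)) A≢A₀
    ... | no  _    = u∈A , refl

    restrict : ConstantOn Lα g → ∀ y → ConstantOn α (g ∘ row y)
    restrict const y A u v u∈A v∈A with A α.≟ A₀
    ... | yes refl = const nothing _ _ (row-∈-base y u u∈A) (row-∈-base y v v∈A)
    ... | no  A≢A₀ = const (just (A given [ A≢A₀ ] , y)) _ _ (row-∈ y A A≢A₀ u u∈A) (row-∈ y A A≢A₀ v v∈A)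

    extend : (∀ y → ConstantOn α (g ∘ row y)) → ConstantOn Lα g
    -- The points `s` and `t` may lie in different rows, so each is compared with `z₀`, the image of
    -- `x₀` in every row.
    extend const nothing s t s∈ t∈ = trans (≡-z₀ s s∈) (sym (≡-z₀ t t∈))
      where
      ≡-z₀ : ∀ z → ⟦ Lα ⟧ nothing z → g z ≡ g z₀
      ≡-z₀ z₀       _    = refl
      ≡-z₀ (pt x y) x∈A₀ = subst₂ (λ s t → g s ≡ g t) (row-value y x) (row-base y)
        (const y A₀ (value x) x₀ x∈A₀ (∈-blockOf α x₀))
    extend const (just (A , y)) (pt u _) (pt v _) (u∈A , refl) (v∈A , refl) =
      subst₂ (λ s t → g s ≡ g t) (row-value y u) (row-value y v)
        (const y (value A) (value u) (value v) u∈A v∈A)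

  -- The coordinates are exchanged: a block away from `z₀` lies in one column, while the block of
  -- `z₀` may spread over several, all of which contain `z₀`.
  L-Y-isLift : IsLiftAlong column (L-Y x₀ y₀)
  L-Y-isLift β g = mk⇔ restrict extend
    where
    module β = Partition β
    B₀ = blockOf β y₀
    Lβ = L-Y x₀ y₀ β

    column-base : ∀ x → column x y₀ ≡ z₀
    column-base x = cong (map (x ,_)) (puncture-base y₀)

    column-value : ∀ x y → column x (value y) ≡ pt x y
    column-value x y = cong (map (x ,_)) (puncture-value y₀ y)

    column-∈-base : ∀ x u → β.⟦ B₀ ⟧ u → ⟦ Lβ ⟧ nothing (column x u)
    column-∈-base x u u∈B₀ with Finite._≟_ finY u y₀
    ... | yes _ = tt
    ... | no  _ = u∈B₀

    column-∈ : ∀ x A (A≢B₀ : A ≢ B₀) u → β.⟦ A ⟧ u → ⟦ Lβ ⟧ (just (x , (A given [ A≢B₀ ]))) (column x u)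
    column-∈ x A A≢B₀ u u∈A with Finite._≟_ finY u y₀
    ... | yes refl = contradiction (β.disjoint u∈A (∈-blockOf β y₀)) A≢B₀
    ... | no  _    = refl , u∈A

    restrict : ConstantOn Lβ g → ∀ x → ConstantOn β (g ∘ column x)
    restrict const x A u v u∈A v∈A with A β.≟ B₀
    ... | yes refl = const nothing _ _ (column-∈-base x u u∈A) (column-∈-base x v v∈A)
    ... | no  A≢B₀ = const (just (x , (A given [ A≢B₀ ]))) _ _ (column-∈ x A A≢B₀ u u∈A) (column-∈ x A A≢B₀ v v∈A)

    extend : (∀ x → ConstantOn β (g ∘ column x)) → ConstantOn Lβ g
    extend const nothing s t s∈ t∈ = trans (≡-z₀ s s∈) (sym (≡-z₀ t t∈))
      where
      ≡-z₀ : ∀ z → ⟦ Lβ ⟧ nothing z → g z ≡ g z₀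
      ≡-z₀ z₀       _    = refl
      ≡-z₀ (pt x y) y∈B₀ = subst₂ (λ s t → g s ≡ g t) (column-value x y) (column-base x)
        (const x B₀ (value y) y₀ y∈B₀ (∈-blockOf β y₀))
    extend const (just (x , A)) (pt _ u) (pt _ v) (refl , u∈A) (refl , v∈A) =
      subst₂ (λ s t → g s ≡ g t) (column-value x u) (column-value x v)
        (const x (value A) (value u) (value v) u∈A v∈A)

lemma4p1 : {X Y : Set} {{_ : Finite X}} {{_ : Finite Y}} (x₀ : X) (y₀ : Y) →
    (∀ (r : ℕ) (α : Fin r → Partition X) →
    ⋁ (λ j → L-X x₀ y₀ (α j)) ≈ L-X x₀ y₀ (⋁ α))
    × (∀ (r : ℕ) (β : Fin r → Partition Y) →
    ⋁ (λ j → L-Y x₀ y₀ (β j)) ≈ L-Y x₀ y₀ (⋁ β))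
lemma4p1 {{finX}} {{finY}} x₀ y₀ =
  (λ r α → lift-preserves-⋁ {{finX}} {{finZ}} {L = L-X x₀ y₀} (L-X-isLift x₀ y₀) α) ,
  (λ r β → lift-preserves-⋁ {{finY}} {{finZ}} {L = L-Y x₀ y₀} (L-Y-isLift x₀ y₀) β)
  -- This is the enumeration of `Z` from which the joins in the statement are computed.
  where finZ = Z-finite {{finX}} {{finY}} {x₀} {y₀}
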